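{- Let $T$ be a semi-special $\omega_1$-Aronszajn tree and let $G=T\#\mathbb{N}$. Then $G$ has exactly one end $\varepsilon$, $\deg(\varepsilon)=\aleph_1$, and $\varepsilon$ has no ray graph (in particular $G$ contains no $\aleph_1$-star of rays of rays in $\varepsilon$).
   Context: Rays, ends, degree of an end, $\omega_1$-trees, Aronszajn trees as usual. $T$ is semi-special if its set of successor nodes is a union of countably many antichains $\langle A_n:n\in\omega\rangle$. For each node $v$ of limit height, $C(T,v)=\{c^{T,v}_n:n\in\omega\}$ is defined recursively: $l_0$ is least with $A_{l_0}\cap[\mathrm{root},v)\ne\emptyset$, $c_0^{T,v}\in A_{l_0}\cap[\mathrm{root},v)$; $l_{n+1}$ is least with $A_{l_{n+1}}\cap(c_n^{T,v},v)\ne\emptyset$, $c_{n+1}^{T,v}\in A_{l_{n+1}}\cap(c^{T,v}_n,v)$. $T\#\mathbb{N}$ has vertex set $T\times\omega$ and edges $\{(u,n),(u,n+1)\}$; $\{(u,n),(v,n)\}$ for all $n$ when $u$ is the predecessor of $v$; and $\{(c^{T,v}_n,n),(v,n)\}$ for $v$ of limit height, $n\in\omega$. A family of paths is independent if the paths meet only in endpoints. Given a set $\mathcal{R}$ of pairwise disjoint equivalent rays and an independent family $\mathcal{P}$ of paths with endpoints on rays of $\mathcal{R}$ (and otherwise disjoint from them), the ray graph of $(\mathcal R,\mathcal P)$ has vertex set $\mathcal{R}$, with $r,s$ adjacent iff infinitely many paths of $\mathcal{P}$ join $r$ and $s$. A ray graph for an end $\varepsilon$ is a connected ray graph on a set $\mathcal{R}\subseteq\varepsilon$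 with $|\mathcal R|=\deg(\varepsilon)$. A $\kappa$-star of rays consists of a central ray and $\kappa$ further rays, all pairwise disjoint, each sending an infinite family of disjoint paths to the central ray, paths from distinct families meeting only on the central ray.
   Formalization: Two rays are adjacent in a ray graph only if infinitely many pairwise disjoint paths of the family join them; if independent paths may share endpoints, a vertex (c_0,0) dominating uncountably many columns gives a ray graph and the claim fails. -}

module Defs where

open import Level using (0ℓ)
open import Data.Nat.Base using (ℕ; suc) renaming (_<_ to _<ⁿ_)
open import Data.Nat.Properties using (1+n≢n)
open import Data.Product.Base using (Σ; ∃; _×_; _,_; proj₁; proj₂)
open import Data.Sum.Base using (_⊎_)
open import Data.List.Base using (List; []; _∷_)
open import Data.List.Membership.Propositional using () renaming (_∈_ to _∈ˡ_)
open import Data.List.Relation.Unary.Unique.Propositional using (Unique)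
open import Function.Base using (_∘_)
open import Function.Bundles using (_↣_)
open import Function.Definitions using (Injective)
open import Induction.WellFounded using (WellFounded)
open import Relation.Binary.Core using (Rel)
open import Relation.Binary.Definitions using (Symmetric)
open import Relation.Binary.Structures using (IsPartialOrder; IsStrictTotalOrder)
open import Relation.Binary.Construct.Closure.ReflexiveTransitive using (Star; _◅_)
  renaming (ε to done)
open import Relation.Binary.Construct.Closure.Symmetric as Sym using (SymClosure; fwd; bwd)
import Relation.Binary.Construct.NonStrictToStrict as NonStrictToStrict
open import Relation.Binary.PropositionalEquality using (_≡_; _≢_; refl; sym; cong)
open import Relation.Nullary.Negation using (¬_)
open import Relation.Unary using (Pred; Satisfiable; U; _∩_; _≐_)

-- P is finite or countably infinite; f is irrelevant outside P.
Countable : {A : Set} → Pred A 0ℓ → Set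
Countable {A} P =
  Σ (A → ℕ) λ f → ∀ {x y} → P x → P y → f x ≡ f y → x ≡ y

Least : Pred ℕ 0ℓ → Pred ℕ 0ℓ
Least P n = P n × (∀ {m} → m <ⁿ n → ¬ P m)

------------------------------------------------------------------------
-- The ordinal ω₁

-- The first uncountable ordinal, presented as the well-ordered set of its
-- elements (the countable ordinals).  These axioms determine it up to a unique
-- isomorphism; its carrier has cardinality ℵ₁.
record Omega₁ : Set₁ where
  field
    Ord                : Set
    _<_                : Rel Ord 0ℓ
    isStrictTotalOrder : IsStrictTotalOrder _≡_ _<_
    wellFounded        : WellFounded _<_
    uncountable        : ¬ Countable {Ord} U
    segmentsCountable  : ∀ α → Countable (λ β → β < α)

  IsLimit : Pred Ord 0ℓ
  IsLimit α = (∃ λ β → β < α) × (∀ {β} → β < α → ∃ λ γ → β < γ × γ < α)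

------------------------------------------------------------------------
-- Order trees

record OrderTree : Set₁ where
  field
    Node           : Set
    _≤_            : Rel Node 0ℓ
    isPartialOrder : IsPartialOrder _≡_ _≤_
    root           : Node
    root≤          : ∀ t → root ≤ t

  open NonStrictToStrict _≡_ _≤_ public using (_<_)

  -- Every set { s | s ≤ t } is well-ordered: it is linearly ordered, and _<_,
  -- whose accessibility at t only concerns nodes below t, is well-founded.
  field
    downTotal      : ∀ {s s′ t} → s ≤ t → s′ ≤ t → s ≤ s′ ⊎ s′ ≤ s
    wellFounded    : WellFounded _<_

  _IsPredecessorOf_ : Rel Node 0ℓ
  u IsPredecessorOf v = u < v × (∀ w → u < w → ¬ w < v)

  IsSuccessorNode : Pred Node 0ℓ
  IsSuccessorNode v = ∃ λ u → u IsPredecessorOf v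

  IsChain : Pred Node 0ℓ → Set
  IsChain P = ∀ {x y} → P x → P y → x ≤ y ⊎ y ≤ x

  IsAntichain : Pred Node 0ℓ → Set
  IsAntichain P = ∀ {x y} → P x → P y → x ≤ y → x ≡ y

module _ (Ω : Omega₁) (T : OrderTree) where
  private
    module Ω = Omega₁ Ω
  open OrderTree T

  -- α is the order type of { x | x < v }: h restricts to an order isomorphism
  -- from { x | x < v } onto { β | β < α }.
  HasHeight : Node → Ω.Ord → Set
  HasHeight v α = Σ (Node → Ω.Ord) λ h →
    (∀ {x} → x < v → h x Ω.< α) ×
    (∀ {x y} → y < v → x < y → h x Ω.< h y) ×
    (∀ {β} → β Ω.< α → ∃ λ x → x < v × h x ≡ β)

  IsLimitNode : Pred Node 0ℓ
  IsLimitNode v = ∃ λ α → HasHeight v α × Ω.IsLimit α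

  record IsAronszajn : Set₁ where
    field
      -- The height of T is ω₁.
      heights         : ∀ v → ∃ λ α → HasHeight v α
      levelsInhabited : ∀ α → ∃ λ v → HasHeight v α
      levelsCountable : ∀ α → Countable (λ v → HasHeight v α)
      chainsCountable : ∀ P → IsChain P → Countable P

module _ (T : OrderTree) where
  open OrderTree T

  record IsSemiSpecial (A : ℕ → Pred Node 0ℓ) : Set where
    field
      antichain : ∀ n → IsAntichain (A n)
      union     : IsSuccessorNode ≐ (λ v → ∃ λ n → A n v)

  [_,_⟩ : Node → Node → Pred Node 0ℓ
  [ x , y ⟩ u = x ≤ u × u < y

  ⟨_,_⟩ : Node → Node → Pred Node 0ℓ
  ⟨ x , y ⟩ u = x < u × u < y

  -- C A v n u says that u is the node cₙ of C(T,v).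
  data C (A : ℕ → Pred Node 0ℓ) (v : Node) : ℕ → Node → Set where
    c₀   : ∀ {l u} →
           Least (λ k → Satisfiable (A k ∩ [ root , v ⟩)) l →
           (A l ∩ [ root , v ⟩) u →
           C A v 0 u
    cₙ₊₁ : ∀ {n c l u} → C A v n c →
           Least (λ k → Satisfiable (A k ∩ ⟨ c , v ⟩)) l →
           (A l ∩ ⟨ c , v ⟩) u →
           C A v (suc n) u

  C⇒< : ∀ {A v n u} → C A v n u → u < v
  C⇒< (c₀ _ (_ , _ , u<v))     = u<v
  C⇒< (cₙ₊₁ _ _ (_ , _ , u<v)) = u<v

------------------------------------------------------------------------
-- Graphs, rays and ends

record Graph : Set₁ where
  field
    Vertex : Set
    _~_    : Rel Vertex 0ℓ
    ~-sym  : Symmetric _~_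
    ~-irr  : ∀ {x} → ¬ x ~ x

module _ (G : Graph) where
  open Graph G

  record Ray : Set where
    field
      at   : ℕ → Vertex
      edge : ∀ n → at n ~ at (suc n)
      inj  : Injective _≡_ _≡_ at

  OnRay : Ray → Pred Vertex 0ℓ
  OnRay r x = ∃ λ n → Ray.at r n ≡ x

  vertices : ∀ {x y} → Star _~_ x y → List Vertex
  vertices {x} done    = x ∷ []
  vertices {x} (_ ◅ w) = x ∷ vertices w

  record Path : Set where
    field
      {source target} : Vertex
      walk            : Star _~_ source target
      simple          : Unique (vertices walk)

  OnPath : Path → Pred Vertex 0ℓ
  OnPath p x = x ∈ˡ vertices (Path.walk p)

  InnerOf : Path → Pred Vertex 0ℓ
  InnerOf p x = OnPath p x × x ≢ Path.source p × x ≢ Path.target p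

  DisjointSets : Pred Vertex 0ℓ → Pred Vertex 0ℓ → Set
  DisjointSets P Q = ∀ {x} → P x → ¬ Q x

  -- A collection of rays is given by an indexing without repetitions:
  -- disjoint rays are in particular distinct.
  PairwiseDisjoint : {I : Set} → (I → Ray) → Set
  PairwiseDisjoint {I} R =
    ∀ {i j : I} → i ≢ j → DisjointSets (OnRay (R i)) (OnRay (R j))

  -- Undirected: a path may be traversed in either direction.
  Joins : Path → Ray → Ray → Set
  Joins p r s =
    (OnRay r (Path.source p) × OnRay s (Path.target p)) ⊎
    (OnRay s (Path.source p) × OnRay r (Path.target p))

  -- The paths P 0, P 1, … form an infinite family of disjoint r–s paths.
  DisjointlyJoins : (ℕ → Path) → Ray → Ray → Set
  DisjointlyJoins P r s =
    (∀ n → Joins (P n) r s) ×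
    (∀ {m n} → m ≢ n → DisjointSets (OnPath (P m)) (OnPath (P n)))

  Equivalent : Rel Ray 0ℓ
  Equivalent r s = Σ (ℕ → Path) λ P → DisjointlyJoins P r s

  -- Ends are equivalence classes of rays, compared up to _≐_.
  IsEnd : Pred Ray 0ℓ → Set
  IsEnd ε = Σ Ray λ r → ε ≐ Equivalent r

  DisjointRaysIn : Pred Ray 0ℓ → Set → Set
  DisjointRaysIn ε I = Σ (I → Ray) λ R → (∀ i → ε (R i)) × PairwiseDisjoint R

  -- deg(ε) = |K|: the maximum cardinality of a set of disjoint rays in ε is |K|.
  HasDegree : Pred Ray 0ℓ → Set → Set₁
  HasDegree ε K = DisjointRaysIn ε K × (∀ (I : Set) → DisjointRaysIn ε I → I ↣ K)

  module _ {I J : Set} (R : I → Ray) (P : J → Path) where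

    record IsPathSystem : Set where
      field
        -- No path contains an inner vertex of another one.
        independent : ∀ {j k} → j ≢ k → DisjointSets (InnerOf (P j)) (OnPath (P k))
        sourceOn    : ∀ j → ∃ λ i → OnRay (R i) (Path.source (P j))
        targetOn    : ∀ j → ∃ λ i → OnRay (R i) (Path.target (P j))
        innerOff    : ∀ j i → DisjointSets (InnerOf (P j)) (OnRay (R i))

    -- Adjacency in the ray graph of (R , P).  The infinitely many paths joining
    -- two rays are disjoint ones, as for equivalence of rays and for stars of
    -- rays.  Independent paths may share end vertices, so without this one
    -- vertex dominating a ray would produce an adjacency.
    RayGraphAdj : Rel I 0ℓ
    RayGraphAdj i k =
      i ≢ k × Σ (ℕ → J) λ f → DisjointlyJoins (P ∘ f) (R i) (R k)

    RayGraphConnected : Set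
    RayGraphConnected = ∀ i k → Star RayGraphAdj i k

  -- A ray graph for ε, on rays indexed by a set I of cardinality deg(ε).
  record RayGraphFor (ε : Pred Ray 0ℓ) : Set₁ where
    field
      {I J}       : Set
      rays        : I → Ray
      raysIn      : ∀ i → ε (rays i)
      disjoint    : PairwiseDisjoint rays
      card        : HasDegree ε I
      paths       : J → Path
      pathSystem  : IsPathSystem rays paths
      connected   : RayGraphConnected rays paths

  -- A |K|-star of rays all of whose rays lie in ε.
  record StarOfRays (ε : Pred Ray 0ℓ) (K : Set) : Set where
    field
      centre         : Ray
      leaf           : K → Ray
      centreIn       : ε centre
      leafIn         : ∀ k → ε (leaf k)
      centreDisjoint : ∀ k → DisjointSets (OnRay centre) (OnRay (leaf k))
      leavesDisjoint : PairwiseDisjoint leaf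
      paths          : K → ℕ → Path
      join           : ∀ k → DisjointlyJoins (paths k) (leaf k) centre
      meetOnCentre   : ∀ {k k′} → k ≢ k′ → ∀ m n {x} →
                       OnPath (paths k m) x → OnPath (paths k′ n) x → OnRay centre x

------------------------------------------------------------------------
-- The graph T # ℕ

module _ (Ω : Omega₁) (T : OrderTree) (A : ℕ → Pred (OrderTree.Node T) 0ℓ) where
  open OrderTree T

  data Edge : Rel (Node × ℕ) 0ℓ where
    vertical  : ∀ u n → Edge (u , n) (u , suc n)
    successor : ∀ {u v} n → u IsPredecessorOf v → Edge (u , n) (v , n)
    limit     : ∀ {u v} n → IsLimitNode Ω T v → C T A v n u → Edge (u , n) (v , n)

  Edge⇒≢ : ∀ {x y} → Edge x y → x ≢ y
  Edge⇒≢ (vertical u n)                  eq = 1+n≢n (sym (cong proj₂ eq))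
  Edge⇒≢ (successor n ((_ , u≢v) , _))   eq = u≢v (cong proj₁ eq)
  Edge⇒≢ (limit n _ c)                   eq = proj₂ (C⇒< T c) (cong proj₁ eq)

  T#ℕ : Graph
  T#ℕ = record
    { Vertex = Node × ℕ
    ; _~_    = SymClosure Edge
    ; ~-sym  = Sym.symmetric Edge
    ; ~-irr  = λ { (fwd e) → Edge⇒≢ e refl ; (bwd e) → Edge⇒≢ e refl }
    }

{-# OPTIONS --safe #-}
module Submission where

-- Every layer T × {n} is connected to (root , n) along predecessors and the nodes cₙ,
-- and all but finitely many vertices of a ray can climb their columns away from a
-- given finite set.  So any two rays can be joined by disjoint paths, chosen greedily,
-- and the set of all rays is the only end.  The columns provide ℵ₁ disjoint rays, and
-- there are only ℵ₁ vertices.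
--
-- Suppose uncountably many disjoint rays send infinite families of disjoint paths to
-- a ray r, with distinct families meeting only on r.  Choose τ above all heights on r,
-- and a limit σ > τ.  The nodes of height < σ are countably many, so it suffices to
-- find for each ray that avoids them a point of height < σ off r on one of its paths.
-- Such a ray lies in the cone above a node v of height σ.  For x ≥ v the part of C(T,x)
-- below v is part of C(T,v), so that paths leave the cone through points (cₙ , n)
-- with cₙ in C(T,v).  Almost all cₙ have height ≥ τ, so some path leaves the cone off r.
-- A connected ray graph on ℵ₁ rays has a vertex of uncountable degree, and thus is
-- excluded together with stars.

open import Defs
open import Level using (0ℓ)
open import Axiom.ExcludedMiddle using (ExcludedMiddle)
open import Data.Bool.Base using (Bool; true; false)
open import Data.Empty using (⊥-elim)
open import Data.List.Base using (List; []; _∷_; _++_; concatMap; map; upTo)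
open import Data.List.Membership.Propositional using (_∈_; _∉_; lose)
open import Data.List.Membership.Propositional.Properties
  using (finite; ∈-map⁺; ∈-++⁺ˡ; ∈-++⁺ʳ; ∈-upTo⁺; ∈-concatMap⁺)
open import Data.List.Relation.Unary.All as All using (All; []; _∷_)
open import Data.List.Relation.Unary.All.Properties using (¬Any⇒All¬)
open import Data.List.Relation.Unary.Any using (here; there)
open import Data.List.Relation.Unary.AllPairs using ([]; _∷_)
open import Data.List.Relation.Unary.Unique.Propositional using (Unique)
open import Data.Nat.Base as ℕ using (ℕ; zero; suc; _+_; z≤n; s≤s)
import Data.Nat.Properties as ℕₚ
open import Data.Nat.Induction using (<-wellFounded)
open import Data.Product.Base using (Σ; ∃; _×_; _,_; proj₁; proj₂)
open import Data.Product.Relation.Binary.Lex.Strict using (×-Lex; ×-wellFounded)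
open import Data.Sum.Base as Sum using (_⊎_; inj₁; inj₂)
open import Data.Unit.Base using (⊤)
open import Function.Base using (id; _∘_)
open import Function.Bundles using (_↣_; mk↣; Injection)
open import Function.Construct.Composition using (_↣-∘_)
open import Function.Definitions using (Injective)
open import Induction.WellFounded using (WellFounded; WfRec; Acc; acc; module FixPoint)
import Induction.WellFounded as WF
open import Relation.Binary.Core using (Rel)
open import Relation.Binary.Definitions using (tri<; tri≈; tri>)
open import Relation.Binary.Construct.Closure.ReflexiveTransitive as Star
  using (Star; _◅_; _◅◅_) renaming (ε to done)
open import Relation.Binary.Construct.Closure.Symmetric using (fwd; bwd)
open import Relation.Binary.PropositionalEquality
  using (_≡_; _≢_; refl; sym; trans; cong; cong₂; subst; ≢-sym)
open import Relation.Binary.Structures using (IsPartialOrder; IsStrictTotalOrder)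
open import Relation.Nullary.Decidable.Core using (Dec; yes; no)
open import Relation.Nullary.Negation using (¬_; contradiction)
open import Relation.Unary using (Pred; Satisfiable; U; _∩_; _∪_; _⊆_; _≐_)

-- Pairing of natural numbers

triangle : ℕ → ℕ
triangle zero    = 0
triangle (suc n) = suc n + triangle n

triangle-mono-≤ : ∀ {m n} → m ℕ.≤ n → triangle m ℕ.≤ triangle n
triangle-mono-≤ z≤n       = z≤n
triangle-mono-≤ (s≤s m≤n) = s≤s (ℕₚ.+-mono-≤ m≤n (triangle-mono-≤ m≤n))

-- Cantor's pairing function: `triangle (a + b)` counts the pairs on earlier antidiagonals.
pair : ℕ × ℕ → ℕ
pair (a , b) = b + triangle (a + b)

pair-mono-< : ∀ a b c d → a + b ℕ.< c + d → pair (a , b) ℕ.< pair (c , d)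
pair-mono-< a b c d lt = begin-strict
  b + triangle (a + b)  <⟨ ℕₚ.+-monoˡ-< _ (s≤s (ℕₚ.m≤n+m b a)) ⟩
  triangle (suc (a + b)) ≤⟨ triangle-mono-≤ lt ⟩
  triangle (c + d)       ≤⟨ ℕₚ.m≤n+m _ d ⟩
  d + triangle (c + d)   ∎
  where open ℕₚ.≤-Reasoning

pair-injective : ∀ {a b c d} → pair (a , b) ≡ pair (c , d) → a ≡ c × b ≡ d
pair-injective {a} {b} {c} {d} eq with ℕₚ.<-cmp (a + b) (c + d)
... | tri< lt _ _ = contradiction eq (ℕₚ.<⇒≢ (pair-mono-< a b c d lt))
... | tri> _ _ gt = contradiction (sym eq) (ℕₚ.<⇒≢ (pair-mono-< c d a b gt))
... | tri≈ _ a+b≡c+d _ =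
  ℕₚ.+-cancelʳ-≡ d a c (trans (cong (a +_) (sym b≡d)) a+b≡c+d) , b≡d
  where
  b≡d : b ≡ d
  b≡d = ℕₚ.+-cancelʳ-≡ (triangle (c + d)) b d
          (trans (cong (λ s → b + triangle s) (sym a+b≡c+d)) eq)

-- Classical principles

module Classical (em : ExcludedMiddle 0ℓ) where

  ¬∀⇒∃¬ : {A : Set} {P : Pred A 0ℓ} → ¬ (∀ x → P x) → ∃ λ x → ¬ P x
  ¬∀⇒∃¬ {P = P} ¬∀ with em {∃ λ x → ¬ P x}
  ... | yes found = found
  ... | no none   = ⊥-elim (¬∀ λ x → stable x em)
    where
    stable : ∀ x → Dec (P x) → P x
    stable x (yes p) = p
    stable x (no ¬p) = ⊥-elim (none (x , ¬p))

  minimal : {A : Set} {_<_ : Rel A 0ℓ} → WellFounded _<_ → {P : Pred A 0ℓ} →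
            ∃ P → ∃ λ m → P m × (∀ {y} → y < m → ¬ P y)
  minimal {_<_ = _<_} wf {P} (x , px) = go x (wf x) px
    where
    go : ∀ x → Acc _<_ x → P x → ∃ λ m → P m × (∀ {y} → y < m → ¬ P y)
    go x (acc rs) px with em {∃ λ y → y < x × P y}
    ... | yes (y , y<x , py) = go y (rs y<x) py
    ... | no none            = x , px , λ y<x py → none (_ , y<x , py)

  escape : {A : Set} {f : ℕ → A} → Injective _≡_ _≡_ f → ∀ xs → ∃ λ n → f n ∉ xs
  escape f-inj xs = ¬∀⇒∃¬ (finite (mk↣ f-inj) xs)

  -- Replaces every proof of `A` by one that depends on `A` alone, so that values computed from a
  -- proof do not vary with it.
  canonical : {A : Set} → A → A
  canonical {A} a with em {A}
  ... | yes a₀ = a₀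
  ... | no _   = a

  canonical-constant : {A : Set} (a b : A) → canonical a ≡ canonical b
  canonical-constant {A} a b with em {A}
  ... | yes _ = refl
  ... | no ¬a = ⊥-elim (¬a a)

  -- Countable sets

  -- The partner of `a` may depend on the proof of `P a`, hence a relation instead of a function;
  -- `em` fixes one proof for each `a`. Equal codes mean equal partners, which `inj` turns into
  -- equal elements.
  countable-via : {A B : Set} {P : Pred A 0ℓ} {Q : Pred B 0ℓ} (_∼_ : A → B → Set) →
                  Countable Q →
                  (∀ {a} → P a → ∃ λ b → Q b × a ∼ b) →
                  (∀ {a a′ b} → P a → P a′ → a ∼ b → a′ ∼ b → a ≡ a′) →
                  Countable P
  countable-via {A} {P = P} {Q} _∼_ (f , f-inj) total inj = (λ a → code em) , code-inj em em
    where
    code : ∀ {a} → Dec (P a) → ℕ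
    code (yes p) = f (proj₁ (total p))
    -- A default outside `P`, where codes are unconstrained.
    code (no _)  = 0

    code-inj : ∀ {x y} (dx : Dec (P x)) (dy : Dec (P y)) → P x → P y →
               code dx ≡ code dy → x ≡ y
    code-inj (no ¬p) _       p  _  _  = ⊥-elim (¬p p)
    code-inj (yes _) (no ¬q) _  q  _  = ⊥-elim (¬q q)
    code-inj (yes p) (yes q) _  _  eq
      with _ , q₁ , r₁ ← total p | _ , q₂ , r₂ ← total q
      with refl ← f-inj q₁ q₂ eq = inj p q r₁ r₂

  countable-⊆ : {A : Set} {P Q : Pred A 0ℓ} → P ⊆ Q → Countable Q → Countable P
  countable-⊆ P⊆Q (f , f-inj) = f , λ px py → f-inj (P⊆Q px) (P⊆Q py)

  countable-× : {A B : Set} {P : Pred A 0ℓ} {Q : Pred B 0ℓ} → Countable P → Countable Q →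
                Countable (λ z → P (proj₁ z) × Q (proj₂ z))
  countable-× (f , f-inj) (g , g-inj) =
    (λ (a , b) → pair (f a , g b)) ,
    λ (pa , qb) (pa′ , qb′) eq → let eq₁ , eq₂ = pair-injective eq in
      cong₂ _,_ (f-inj pa pa′ eq₁) (g-inj qb qb′ eq₂)

  ℕ-countable : Countable {ℕ} U
  ℕ-countable = id , λ _ _ eq → eq

  countable-⋃ : {A B : Set} {Q : Pred B 0ℓ} {P : B → Pred A 0ℓ} →
                Countable Q → (∀ b → Countable (P b)) →
                Countable (λ a → ∃ λ b → Q b × P b a)
  countable-⋃ {P = P} Q-countable P-countable =
    countable-via
      (λ a (b , n) → P b a × proj₁ (P-countable b) a ≡ n)
      (countable-× Q-countable ℕ-countable)
      (λ (b , qb , pba) → (b , _) , (qb , _) , pba , refl)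
      (λ { {b = b , _} _ _ (p , eq) (p′ , eq′) →
           proj₂ (P-countable b) p p′ (trans eq (sym eq′)) })

  countable-∪ : {A : Set} {P Q : Pred A 0ℓ} → Countable P → Countable Q → Countable (P ∪ Q)
  countable-∪ {A} {P} {Q} cp cq =
    countable-⊆ (λ { (inj₁ p) → false , _ , p ; (inj₂ q) → true , _ , q })
                (countable-⋃ {Q = U} {P = pick} bool-countable
                             λ { false → cp ; true → cq })
    where
    pick : Bool → Pred A 0ℓ
    pick false = P
    pick true  = Q
    bool-countable : Countable {Bool} U
    bool-countable = (λ { false → 0 ; true → 1 }) ,
      λ { {false} {false} _ _ _ → refl ; {true} {true} _ _ _ → refl }

  countable-singleton : {A : Set} (a : A) → Countable (_≡ a)
  countable-singleton a = (λ _ → 0) , λ p q _ → trans p (sym q)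

  -- From a fixed start, the numbers of the successive steps determine where a walk ends; iterated
  -- pairing codes this finite sequence.
  countable-Star : {A : Set} {R : Rel A 0ℓ} → (∀ a → Countable (R a)) →
                   ∀ a → Countable (Star R a)
  countable-Star {A} {R} R-countable a =
    countable-via (λ b n → Σ (Star R a b) λ w → code w ≡ n) ℕ-countable
      (λ w → code w , _ , w , refl)
      (λ _ _ (w , eq) (w′ , eq′) → code-inj w w′ (trans eq (sym eq′)))
    where
    code : ∀ {a b} → Star R a b → ℕ
    code done                  = 0
    -- `suc` keeps the code apart from the 0 of the empty walk.
    code {a} (_◅_ {j = b} _ w) = suc (pair (proj₁ (R-countable a) b , code w))

    code-inj : ∀ {a b c} (w : Star R a b) (w′ : Star R a c) → code w ≡ code w′ → b ≡ c
    code-inj done    done      _  = refl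
    code-inj {a} (r ◅ w) (r′ ◅ w′) eq
      with eq₁ , eq₂ ← pair-injective (ℕₚ.suc-injective eq)
      with refl ← proj₂ (R-countable a) r r′ eq₁ = code-inj w w′ eq₂

  -- Countable ordinals

  module Ordinals (Ω : Omega₁) where
    open Omega₁ Ω
    open IsStrictTotalOrder isStrictTotalOrder public
      using (compare) renaming (trans to <-trans; irrefl to <-irrefl; asym to <-asym)

    ≮⇒≥ : ∀ {α β} → ¬ α < β → β < α ⊎ β ≡ α
    ≮⇒≥ {α} {β} α≮β with compare α β
    ... | tri< α<β _ _ = ⊥-elim (α≮β α<β)
    ... | tri≈ _ α≡β _ = inj₂ (sym α≡β)
    ... | tri> _ _ α>β = inj₁ α>β

    ≤-<-trans : ∀ {α β γ} → α < β ⊎ α ≡ β → β < γ → α < γ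
    ≤-<-trans (inj₁ α<β)  β<γ = <-trans α<β β<γ
    ≤-<-trans (inj₂ refl) β<γ = β<γ

    minimum-unique : {P : Pred Ord 0ℓ} {α β : Ord} →
                     P α → (∀ {γ} → γ < α → ¬ P γ) →
                     P β → (∀ {γ} → γ < β → ¬ P γ) → α ≡ β
    minimum-unique {α = α} {β} pα minα pβ minβ with compare α β
    ... | tri< α<β _ _ = ⊥-elim (minβ α<β pα)
    ... | tri≈ _ α≡β _ = α≡β
    ... | tri> _ _ α>β = ⊥-elim (minα α>β pβ)

    closedSegment-countable : ∀ α → Countable (λ β → β < α ⊎ β ≡ α)
    closedSegment-countable α = countable-∪ (segmentsCountable α) (countable-singleton α)

    -- Otherwise the countably many countable closed segments up to the `s n` would cover ω₁.
    strictBound : (s : ℕ → Ord) → ∃ λ β → ∀ n → s n < β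
    strictBound s with em {∃ λ β → ∀ n → s n < β}
    ... | yes bound = bound
    ... | no none   = ⊥-elim (uncountable (countable-⊆ cover
                        (countable-⋃ ℕ-countable (closedSegment-countable ∘ s))))
      where
      cover : ∀ {β} → U β → ∃ λ n → U n × (β < s n ⊎ β ≡ s n)
      cover {β} _ = let n , sn≮β = ¬∀⇒∃¬ (λ all → none (β , all)) in n , _ , ≮⇒≥ sn≮β

    -- The least strict upper bound of a strictly increasing sequence starting at `α` is a limit:
    -- any smaller `β` is at most some `s n`, hence below `s (suc n)`.
    limitAbove : ∀ α → ∃ λ λ′ → α < λ′ × IsLimit λ′
    limitAbove α = σ , below 0 , (α , below 0) , between
      where
      above : ∀ β → ∃ λ γ → β < γ
      above β = let γ , β<γ = strictBound (λ _ → β) in γ , β<γ 0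

      s : ℕ → Ord
      s zero    = α
      s (suc n) = proj₁ (above (s n))

      supremum : ∃ λ σ → (∀ n → s n < σ) × (∀ {β} → β < σ → ¬ (∀ n → s n < β))
      supremum = minimal wellFounded (strictBound s)

      σ : Ord
      σ = proj₁ supremum

      below : ∀ n → s n < σ
      below = proj₁ (proj₂ supremum)

      between : ∀ {β} → β < σ → ∃ λ γ → β < γ × γ < σ
      between β<σ =
        let n , sn≮β = ¬∀⇒∃¬ (proj₂ (proj₂ supremum) β<σ)
        in s (suc n) , ≤-<-trans (≮⇒≥ sn≮β) (proj₂ (above (s n))) , below (suc n)

    -- The cardinal equation ℵ₁ · ℵ₀ = ℵ₁

    _≺_ : Rel (Ord × ℕ) 0ℓ
    _≺_ = ×-Lex _≡_ _<_ ℕ._<_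

    ≺-wellFounded : WellFounded _≺_
    ≺-wellFounded = ×-wellFounded wellFounded <-wellFounded

    ≺-connex : ∀ {x y} → x ≢ y → x ≺ y ⊎ y ≺ x
    ≺-connex {α , m} {β , n} x≢y with compare α β | ℕₚ.<-cmp m n
    ... | tri< α<β _ _  | _            = inj₁ (inj₁ α<β)
    ... | tri> _ _ α>β  | _            = inj₂ (inj₁ α>β)
    ... | tri≈ _ refl _ | tri< m<n _ _ = inj₁ (inj₂ (refl , m<n))
    ... | tri≈ _ refl _ | tri> _ _ m>n = inj₂ (inj₂ (refl , m>n))
    ... | tri≈ _ refl _ | tri≈ _ refl _ = ⊥-elim (x≢y refl)

    ≺-segments-countable : ∀ x → Countable (_≺ x)
    ≺-segments-countable (α , n) =
      countable-⊆ (λ { (inj₁ β<α) → inj₁ β<α , _ ; (inj₂ (β≡α , _)) → inj₂ β≡α , _ })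
                  (countable-× (closedSegment-countable α) ℕ-countable)

    -- Each pair is sent to the least ordinal that is not the image of a smaller
    -- pair; such an ordinal exists as there are only countably many smaller pairs.
    Ord×ℕ↣Ord : (Ord × ℕ) ↣ Ord
    Ord×ℕ↣Ord = mk↣ {to = f} f-injective
      where
      Unused : ∀ x → WfRec _≺_ (λ _ → Ord) x → Pred Ord 0ℓ
      Unused x IH γ = ∀ {y} (y≺x : y ≺ x) → IH (canonical y≺x) ≢ γ

      leastUnused : ∀ x (IH : WfRec _≺_ (λ _ → Ord) x) →
                    ∃ λ γ → Unused x IH γ × (∀ {δ} → δ < γ → ¬ Unused x IH δ)
      leastUnused x IH with em {∃ (Unused x IH)}
      ... | yes found = minimal wellFounded found
      -- Every ordinal would be a value at one of the countably many smaller pairs; `canonical`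
      -- ensures that each pair accounts for only one value.
      ... | no none   = ⊥-elim (uncountable (countable-via
              (λ γ y → Σ (y ≺ x) λ y≺x → IH (canonical y≺x) ≡ γ)
              (≺-segments-countable x)
              (λ {γ} _ → used γ em)
              λ { _ _ (p , refl) (q , refl) → cong IH (canonical-constant p q) }))
        where
        used : ∀ γ → Dec (∃ λ y → Σ (y ≺ x) λ y≺x → IH (canonical y≺x) ≡ γ) →
               ∃ λ y → y ≺ x × Σ (y ≺ x) λ y≺x → IH (canonical y≺x) ≡ γ
        used γ (yes (y , p , eq)) = y , p , p , eq
        used γ (no unused) = ⊥-elim (none (γ , λ p eq → unused (_ , p , eq)))

      step : ∀ x → WfRec _≺_ (λ _ → Ord) x → Ord
      step x IH = proj₁ (leastUnused x IH)

      step-ext : ∀ x {IH IH′ : WfRec _≺_ (λ _ → Ord) x} →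
                 (∀ {y} y≺x → IH {y} y≺x ≡ IH′ y≺x) → step x IH ≡ step x IH′
      step-ext x {IH} {IH′} eq =
        let _ , unused , least = leastUnused x IH
            _ , unused′ , least′ = leastUnused x IH′
        in minimum-unique {P = Unused x IH} unused least
             (λ p e → unused′ p (trans (sym (eq _)) e))
             (λ δ<γ u → least′ δ<γ λ p e → u p (trans (eq _) e))

      open FixPoint ≺-wellFounded (λ _ → Ord) step step-ext

      f : Ord × ℕ → Ord
      f = WF.All.wfRec ≺-wellFounded 0ℓ (λ _ → Ord) step

      f-fresh : ∀ {x y} → y ≺ x → f y ≢ f x
      f-fresh {x} y≺x eq =
        proj₁ (proj₂ (leastUnused x (λ _ → f _))) y≺x (trans eq (unfold-wfRec {x}))

      f-injective : ∀ {x y} → f x ≡ f y → x ≡ y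
      f-injective {x} {y} eq with em {x ≡ y}
      ... | yes x≡y = x≡y
      ... | no x≢y with ≺-connex x≢y
      ...   | inj₁ x≺y = ⊥-elim (f-fresh x≺y eq)
      ...   | inj₂ y≺x = ⊥-elim (f-fresh y≺x (sym eq))

  -- Heights in order trees

  module Heights (Ω : Omega₁) (T : OrderTree) where
    private module Ω = Omega₁ Ω
    open Ordinals Ω
    open OrderTree T
    open IsPartialOrder isPartialOrder public
      using (antisym) renaming (refl to ≤-refl; trans to ≤-trans)

    <-≤-trans : ∀ {x y z} → x < y → y ≤ z → x < z
    <-≤-trans (x≤y , x≢y) y≤z = ≤-trans x≤y y≤z , λ { refl → x≢y (antisym x≤y y≤z) }

    ≤-<-transᵗ : ∀ {x y z} → x ≤ y → y < z → x < z
    ≤-<-transᵗ x≤y (y≤z , y≢z) = ≤-trans x≤y y≤z , λ { refl → y≢z (antisym y≤z x≤y) }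

    <⇒≱ : ∀ {x y} → x < y → ¬ y ≤ x
    <⇒≱ (x≤y , x≢y) y≤x = x≢y (antisym x≤y y≤x)

    ≤⊎> : ∀ {x y z} → x ≤ z → y ≤ z → x ≤ y ⊎ y < x
    ≤⊎> {x} {y} x≤z y≤z with em {x ≤ y}
    ... | yes x≤y = inj₁ x≤y
    ... | no x≰y with downTotal x≤z y≤z
    ...   | inj₁ x≤y = inj₁ x≤y
    ...   | inj₂ y≤x = inj₂ (y≤x , λ { refl → x≰y ≤-refl })

    reflect-< : ∀ {v α} ((h , _) : HasHeight Ω T v α) {x y} →
                x < v → y < v → h x Ω.< h y → x < y
    reflect-< (h , _ , mono , _) {x} {y} x<v y<v hx<hy with ≤⊎> (proj₁ y<v) (proj₁ x<v)
    ... | inj₂ x<y = x<y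
    ... | inj₁ y≤x with em {y ≡ x}
    ...   | yes refl = ⊥-elim (<-irrefl refl hx<hy)
    ...   | no y≢x   = ⊥-elim (<-asym hx<hy (mono x<v (y≤x , y≢x)))

    -- The map `h` for `v` also serves for `x`; by `reflect-<` the nodes mapped below `h x` do lie
    -- below `x`.
    height-below : ∀ {v α} ((h , _) : HasHeight Ω T v α) {x} → x < v → HasHeight Ω T x (h x)
    height-below H@(h , h< , mono , surj) {x} x<v =
      h , mono x<v , (λ y<x → mono (<-≤-trans y<x (proj₁ x<v))) , onto
      where
      onto : ∀ {β} → β Ω.< h x → ∃ λ y → y < x × h y ≡ β
      onto β<hx with y , y<v , refl ← surj (<-trans β<hx (h< x<v)) =
        y , reflect-< H y<v x<v β<hx , refl

    -- If `α < β`, then some `x < v` receives `α` from the second witness but a value below `α` from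
    -- the first, against uniqueness at `x`.
    height-unique : ∀ {v α β} → HasHeight Ω T v α → HasHeight Ω T v β → α ≡ β
    height-unique {v} = go v (wellFounded v)
      where
      go : ∀ v → Acc _<_ v → ∀ {α β} → HasHeight Ω T v α → HasHeight Ω T v β → α ≡ β
      ≮ : ∀ v → Acc _<_ v → ∀ {α β} → HasHeight Ω T v α → HasHeight Ω T v β → ¬ α Ω.< β
      go v a {α} {β} H K with compare α β
      ... | tri< α<β _ _ = ⊥-elim (≮ v a H K α<β)
      ... | tri≈ _ α≡β _ = α≡β
      ... | tri> _ _ β<α = ⊥-elim (≮ v a K H β<α)
      ≮ v (acc rs) H@(h , h< , _) K@(_ , _ , _ , surj) α<β
        with x , x<v , refl ← surj α<β =
        <-irrefl (go x (rs x<v) (height-below H x<v) (height-below K x<v)) (h< x<v)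

    -- Levels and limit nodes of an Aronszajn tree

    module Aronszajn (aronszajn : IsAronszajn Ω T) where
      open IsAronszajn aronszajn

      ht : Node → Ω.Ord
      ht v = proj₁ (heights v)

      hasHeight : ∀ v → HasHeight Ω T v (ht v)
      hasHeight v = proj₂ (heights v)

      ht-mono-< : ∀ {x y} → x < y → ht x Ω.< ht y
      ht-mono-< {x} {y} x<y =
        subst (Ω._< ht y) (height-unique (height-below (hasHeight y) x<y) (hasHeight x))
              (proj₁ (proj₂ (hasHeight y)) x<y)

      ht-≤ : ∀ {x y} → x ≤ y → ht x Ω.< ht y ⊎ ht x ≡ ht y
      ht-≤ {x} {y} x≤y with em {x ≡ y}
      ... | yes refl = inj₂ refl
      ... | no x≢y   = inj₁ (ht-mono-< (x≤y , x≢y))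

      ancestorAt : ∀ {x α} → ¬ ht x Ω.< α → ∃ λ v → v ≤ x × ht v ≡ α
      ancestorAt {x} hx≮α with ≮⇒≥ hx≮α
      ... | inj₂ refl = x , ≤-refl , refl
      ... | inj₁ α<hx with v , v<x , refl ← proj₂ (proj₂ (proj₂ (hasHeight x))) α<hx =
        v , proj₁ v<x , height-unique (hasHeight v) (height-below (hasHeight x) v<x)

      -- Limit height leaves nodes strictly between `c` and `v`, and a minimal one has `c` as its
      -- predecessor. Being a successor node, it lies in some antichain `A l`.
      immediateSuccessor : ∀ {c v} → IsLimitNode Ω T v → c < v →
                           ∃ λ w → c IsPredecessorOf w × w < v
      immediateSuccessor {c} {v} (α , H@(h , h< , _ , surj) , _ , between) c<v
        with _ , hc<γ , γ<α ← between (h< c<v)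
        with y , y<v , refl ← surj γ<α
        with w , (c<w , w<v) , least ← minimal wellFounded {λ x → c < x × x < v}
                                        (y , reflect-< H c<v y<v hc<γ , y<v) =
        w , (c<w , λ x c<x x<w → least x<w (c<x , <-≤-trans x<w (proj₁ w<v))) , w<v

      limit⇒root< : ∀ {v} → IsLimitNode Ω T v → root < v
      limit⇒root< (_ , (_ , _ , _ , surj) , (_ , β<α) , _) =
        ≤-<-transᵗ (root≤ _) (proj₁ (proj₂ (surj β<α)))

      classify : ∀ v → v ≡ root ⊎ IsSuccessorNode v ⊎ IsLimitNode Ω T v
      classify v with em {root ≡ v} | em {IsSuccessorNode v}
      ... | yes refl | _        = inj₁ refl
      ... | no _     | yes succ = inj₂ (inj₁ succ)
      ... | no r≢v   | no ¬succ = inj₂ (inj₂ (ht v , H , (h root , h< (root≤ v , r≢v)) , between))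
        where
        H = hasHeight v
        h = proj₁ H
        h< = proj₁ (proj₂ H)

        between : ∀ {β} → β Ω.< ht v → ∃ λ γ → β Ω.< γ × γ Ω.< ht v
        between β<α
          with u , u<v , refl ← proj₂ (proj₂ (proj₂ H)) β<α
          with w , ¬gap ← ¬∀⇒∃¬ (λ gap → ¬succ (u , u<v , λ w u<w w<v → gap w (u<w , w<v)))
          with em {u < w × w < v}
        ... | yes (u<w , w<v) = h w , proj₁ (proj₂ (proj₂ H)) w<v u<w , h< w<v
        ... | no ¬uwv         = ⊥-elim (¬gap ¬uwv)

      levelNode : Ω.Ord → Node
      levelNode α = proj₁ (levelsInhabited α)

      levelNode-injective : Injective _≡_ _≡_ levelNode
      levelNode-injective {α} {β} eq =
        height-unique (proj₂ (levelsInhabited α))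
                      (subst (λ v → HasHeight Ω T v β) (sym eq) (proj₂ (levelsInhabited β)))

      -- A node is determined by its height and its number in its countable level.
      Node×ℕ↣Ord : (Node × ℕ) ↣ Ω.Ord
      Node×ℕ↣Ord = Ord×ℕ↣Ord ↣-∘ mk↣ {to = key} key-injective
        where
        key : Node × ℕ → Ω.Ord × ℕ
        key (v , n) = ht v , pair (proj₁ (levelsCountable (ht v)) v , n)

        key-injective : Injective _≡_ _≡_ key
        key-injective {v , m} {w , n} eq =
          same (cong proj₁ eq) (hasHeight w) (cong proj₂ eq)
          where
          -- The numbering depends on the level, so the height of `w` becomes a variable before the
          -- two levels are identified.
          same : ∀ {α} → ht v ≡ α → HasHeight Ω T w α →
                 pair (proj₁ (levelsCountable (ht v)) v , m) ≡
                 pair (proj₁ (levelsCountable α) w , n) → (v , m) ≡ (w , n)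
          same refl w-height eq′ = let eq₁ , eq₂ = pair-injective eq′ in
            cong₂ _,_ (proj₂ (levelsCountable (ht v)) (hasHeight v) w-height eq₁) eq₂

      below-countable : ∀ σ → Countable (λ v → ht v Ω.< σ)
      below-countable σ =
        countable-⊆ (λ {v} v<σ → ht v , v<σ , hasHeight v)
                    (countable-⋃ (Ω.segmentsCountable σ) levelsCountable)

      -- The sequences C(T,v)

      module Sequences {A : ℕ → Pred Node 0ℓ} (semiSpecial : IsSemiSpecial T A) where
        open IsSemiSpecial semiSpecial

        -- Nodes below `v` are comparable; hence a label determines the node chosen as `cₙ`.
        antichain-equal : ∀ {n u w v} → A n u → A n w → u < v → w < v → u ≡ w
        antichain-equal Au Aw u<v w<v with downTotal (proj₁ u<v) (proj₁ w<v)
        ... | inj₁ u≤w = antichain _ Au Aw u≤w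
        ... | inj₂ w≤u = sym (antichain _ Aw Au w≤u)

        leastLabel : {X : Pred Node 0ℓ} → ∃ (IsSuccessorNode ∩ X) →
                     ∃ λ l → Least (λ k → Satisfiable (A k ∩ X)) l × Satisfiable (A l ∩ X)
        leastLabel (u , succ , x) with l , Al ← proj₁ union succ
          with l , sat , least ← minimal <-wellFounded (l , u , Al , x) = l , (sat , least) , sat

        C-exists : ∀ {v} → IsLimitNode Ω T v → ∀ n → ∃ (C T A v n)
        C-exists lim zero
          with w , pred , w<v ← immediateSuccessor lim (limit⇒root< lim)
          with l , least , u , Al∩ ← leastLabel (w , (_ , pred) , root≤ w , w<v) =
          u , c₀ least Al∩
        C-exists lim (suc n)
          with c , Cc ← C-exists lim n
          with w , pred , w<v ← immediateSuccessor lim (C⇒< T Cc)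
          with l , least , u , Al∩ ← leastLabel (w , (_ , pred) , proj₁ pred , w<v) =
          u , cₙ₊₁ Cc least Al∩

        Least-unique : {P : Pred ℕ 0ℓ} {m n : ℕ} → Least P m → Least P n → m ≡ n
        Least-unique {m = m} {n} (pm , minm) (pn , minn) with ℕₚ.<-cmp m n
        ... | tri< m<n _ _ = ⊥-elim (minn m<n pm)
        ... | tri≈ _ m≡n _ = m≡n
        ... | tri> _ _ m>n = ⊥-elim (minm m>n pn)

        C-unique : ∀ {v n u w} → C T A v n u → C T A v n w → u ≡ w
        C-unique (c₀ l (Au , _ , u<v)) (c₀ l′ (Aw , _ , w<v))
          with refl ← Least-unique l l′ = antichain-equal Au Aw u<v w<v
        C-unique (cₙ₊₁ Cc l (Au , _ , u<v)) (cₙ₊₁ Cc′ l′ (Aw , _ , w<v))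
          with refl ← C-unique Cc Cc′
          with refl ← Least-unique l l′ = antichain-equal Au Aw u<v w<v

        -- The least label up to `x` is attained by `u`, already below `v`, and the shorter interval
        -- offers no smaller label. So both recursions make the same choices up to `u`.
        C-restrict : ∀ {v x n u} → v ≤ x → C T A x n u → u < v → C T A v n u
        C-restrict v≤x (c₀ (_ , least) (Au , r≤u , _)) u<v =
          c₀ ((_ , Au , r≤u , u<v) ,
              λ m<l (w , Aw , r≤w , w<v) → least m<l (w , Aw , r≤w , <-≤-trans w<v v≤x))
             (Au , r≤u , u<v)
        C-restrict v≤x (cₙ₊₁ Cc (_ , least) (Au , c<u , _)) u<v =
          cₙ₊₁ (C-restrict v≤x Cc (≤-<-transᵗ (proj₁ c<u) u<v))
             ((_ , Au , c<u , u<v) ,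
              λ m<l (w , Aw , c<w , w<v) → least m<l (w , Aw , c<w , <-≤-trans w<v v≤x))
             (Au , c<u , u<v)

        -- `k < l` contradicts minimality, and `k = l` would put two comparable nodes into one
        -- antichain.
        least-label-< : ∀ {X : Pred Node 0ℓ} {l k u w} →
          Least (λ k → Satisfiable (A k ∩ X)) l → A l u → u < w → A k w → X w → l ℕ.< k
        least-label-< {l = l} {k} (_ , least) Au (u≤w , u≢w) Aw Xw with ℕₚ.<-cmp l k
        ... | tri< l<k _ _  = l<k
        ... | tri≈ _ refl _ = ⊥-elim (u≢w (antichain _ Au Aw u≤w))
        ... | tri> _ _ k<l  = ⊥-elim (least k<l (_ , Aw , Xw))

        -- The labels of the nodes cₙ increase strictly, so n is at most the label of
        -- cₙ; this makes C(T,v) cofinal below v.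
        C-label : ∀ {v n u} → C T A v n u →
                  ∃ λ l → n ℕ.≤ l × (∀ {w k} → u < w → w < v → A k w → l ℕ.< k)
        C-label (c₀ {l = l} least (Au , r≤u , _)) =
          l , z≤n , λ u<w w<v Aw → least-label-< least Au u<w Aw (root≤ _ , w<v)
        C-label (cₙ₊₁ {l = l} Cc least (Au , c<u , u<v)) with l′ , n≤l′ , bound ← C-label Cc =
          l , ℕₚ.≤-<-trans n≤l′ (bound c<u u<v Au) ,
          λ u<w w<v Aw → least-label-< least Au u<w Aw (<-≤-trans c<u (proj₁ u<w) , w<v)

        C-label-bound : ∀ {v n u w k} → C T A v n u → u < w → w < v → A k w → n ℕ.< k
        C-label-bound c u<w w<v Aw = let _ , n≤l , bound = C-label c in
          ℕₚ.≤-<-trans n≤l (bound u<w w<v Aw)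

  -- Walks and rays

  module Walks (G : Graph) where
    open Graph G

    source∈ : ∀ {x y} (w : Star _~_ x y) → x ∈ vertices G w
    source∈ done    = here refl
    source∈ (_ ◅ _) = here refl

    suffix : ∀ {x y z} (w : Star _~_ x y) → Unique (vertices G w) → z ∈ vertices G w →
             Σ (Star _~_ z y) λ w′ → Unique (vertices G w′) × (_∈ vertices G w′) ⊆ (_∈ vertices G w)
    suffix done    u       (here refl) = done , u , id
    suffix (e ◅ w) u       (here refl) = e ◅ w , u , id
    suffix (e ◅ w) (_ ∷ u) (there z∈w) = let w′ , u′ , w′⊆w = suffix w u z∈w in
      w′ , u′ , there ∘ w′⊆w

    -- Loop erasure: if `x` recurs in the simplified remainder, only the part from that occurrence
    -- on is kept.
    simplify : ∀ {x y} (w : Star _~_ x y) →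
               Σ (Star _~_ x y) λ w′ → Unique (vertices G w′) × (_∈ vertices G w′) ⊆ (_∈ vertices G w)
    simplify done = done , [] ∷ [] , id
    simplify {x} (e ◅ w) with w′ , u , w′⊆w ← simplify w with em {x ∈ vertices G w′}
    ... | no x∉w′  = e ◅ w′ , ¬Any⇒All¬ _ x∉w′ ∷ u ,
                     λ { (here eq) → here eq ; (there v∈w′) → there (w′⊆w v∈w′) }
    ... | yes x∈w′ = let w″ , u″ , w″⊆w′ = suffix w′ u x∈w′ in
                     w″ , u″ , there ∘ w′⊆w ∘ w″⊆w′

    -- Walks crossing the boundary of a vertex set

    module _ {P Q : Pred Vertex 0ℓ} (exit : ∀ {x y} → P x → ¬ P y → x ~ y → Q y) where

      exit-vertex : ∀ {x y} (w : Star _~_ x y) → P x → ¬ P y → ∃ λ z → z ∈ vertices G w × Q z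
      exit-vertex done    px ¬py = ⊥-elim (¬py px)
      exit-vertex (_◅_ {j = j} e w) px ¬py with em {P j}
      ... | yes pj = let z , z∈w , qz = exit-vertex w pj ¬py in z , there z∈w , qz
      ... | no ¬pj = j , there (source∈ w) , exit px ¬pj e

      -- The edge by which the walk enters `P`, read backwards, leaves `P`.
      entry-vertex : ∀ {x y} (w : Star _~_ x y) → ¬ P x → P y → ∃ λ z → z ∈ vertices G w × Q z
      entry-vertex done    ¬px py = ⊥-elim (¬px py)
      entry-vertex {x} (_◅_ {j = j} e w) ¬px py with em {P j}
      ... | yes pj = x , here refl , exit pj ¬px (~-sym e)
      ... | no ¬pj = let z , z∈w , qz = entry-vertex w ¬pj py in z , there z∈w , qz

    -- Greedy construction of disjoint paths

    Inside : Pred Vertex 0ℓ → Rel Vertex 0ℓ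
    Inside P x y = x ~ y × P x × P y

    walk-inside : ∀ {P x y} → P x → Star (Inside P) x y →
                  Σ (Star _~_ x y) λ w → All P (vertices G w)
    walk-inside px done = done , px ∷ []
    walk-inside px ((e , _ , pj) ◅ w) = let w′ , all = walk-inside pj w in e ◅ w′ , px ∷ all

    reverse-inside : ∀ {P x y} → Star (Inside P) x y → Star (Inside P) y x
    reverse-inside = Star.reverse λ (e , px , py) → ~-sym e , py , px

    equivalent : (r s : Ray G) →
                 (∀ X → ∃ λ i → ∃ λ j → Ray.at r i ∉ X ×
                    Star (Inside (_∉ X)) (Ray.at r i) (Ray.at s j)) →
                 Equivalent G r s
    equivalent r s connect = (λ n → proj₁ (next (used n))) , joins , disjoint
      where
      next : ∀ X → Σ (Path G) λ p → Joins G p r s × (∀ {z} → OnPath G p z → z ∉ X)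
      next X =
        let i , j , ri∉X , w = connect X
            w₁ , avoids      = walk-inside ri∉X w
            w₂ , u , w₂⊆w₁   = simplify w₁
        in record { walk = w₂ ; simple = u } , inj₁ ((i , refl) , (j , refl)) ,
           All.lookup avoids ∘ w₂⊆w₁

      used : ℕ → List Vertex
      used zero    = []
      used (suc n) = vertices G (Path.walk (proj₁ (next (used n)))) ++ used n

      P : ℕ → Path G
      P n = proj₁ (next (used n))

      joins : ∀ n → Joins G (P n) r s
      joins n = proj₁ (proj₂ (next (used n)))

      used-⊇ : ∀ {m n z} → m ℕ.<′ n → OnPath G (P m) z → z ∈ used n
      used-⊇ ℕ.<′-base       z∈ = ∈-++⁺ˡ z∈
      used-⊇ (ℕ.<′-step m<n) z∈ = ∈-++⁺ʳ _ (used-⊇ m<n z∈)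

      disjoint-< : ∀ {m n z} → m ℕ.< n → OnPath G (P m) z → ¬ OnPath G (P n) z
      disjoint-< {n = n} m<n z∈m z∈n =
        proj₂ (proj₂ (next (used n))) z∈n (used-⊇ (ℕₚ.<⇒<′ m<n) z∈m)

      disjoint : ∀ {m n} → m ≢ n → DisjointSets G (OnPath G (P m)) (OnPath G (P n))
      disjoint {m} {n} m≢n z∈m z∈n with ℕₚ.<-cmp m n
      ... | tri< m<n _ _ = disjoint-< m<n z∈m z∈n
      ... | tri≈ _ m≡n _ = m≢n m≡n
      ... | tri> _ _ m>n = disjoint-< m>n z∈n z∈m

    -- Ray graphs and stars of rays

    Endpoint : Path G → Pred Vertex 0ℓ
    Endpoint p x = x ≡ Path.source p ⊎ x ≡ Path.target p

    endpoint-or-inner : ∀ p {x} → OnPath G p x → Endpoint p x ⊎ InnerOf G p x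
    endpoint-or-inner p {x} x∈p with em {x ≡ Path.source p} | em {x ≡ Path.target p}
    ... | yes eq | _      = inj₁ (inj₁ eq)
    ... | no _   | yes eq = inj₁ (inj₂ eq)
    ... | no ≢s  | no ≢t  = inj₂ (x∈p , ≢s , ≢t)

    endpoint-on : ∀ {p r s x} → Joins G p r s → Endpoint p x → OnRay G r x ⊎ OnRay G s x
    endpoint-on (inj₁ (r , s)) (inj₁ refl) = inj₁ r
    endpoint-on (inj₁ (r , s)) (inj₂ refl) = inj₂ s
    endpoint-on (inj₂ (s , r)) (inj₁ refl) = inj₂ s
    endpoint-on (inj₂ (s , r)) (inj₂ refl) = inj₁ r

    -- The hypotheses cover both a star of rays and, with Q the neighbourhood of r, a ray graph.
    CountableSpokes : Set₁
    CountableSpokes =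
      ∀ (r : Ray G) {I : Set} {Q : Pred I 0ℓ} (leaf : I → Ray G) → PairwiseDisjoint G leaf →
      (paths : ∀ {k} → Q k → ℕ → Path G) →
      (∀ {k} (q : Q k) → DisjointlyJoins G (paths q) (leaf k) r) →
      (∀ {k k′} → k ≢ k′ → (q : Q k) (q′ : Q k′) → ∀ m n {x} →
         OnPath G (paths q m) x → OnPath G (paths q′ n) x → OnRay G r x) →
      Countable Q

    -- A connected graph in which every vertex has countable degree is countable.
    rayGraph-countable : CountableSpokes → ∀ {ε} (rg : RayGraphFor G ε) →
                         Countable {RayGraphFor.I rg} U
    rayGraph-countable spokes rg with em {I}
      where open RayGraphFor rg
    ... | no ¬i = (λ _ → 0) , λ {i} → ⊥-elim (¬i i)
    ... | yes i₀ = countable-⊆ (λ {k} _ → connected i₀ k) (countable-Star neighbours i₀)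
      where
      open RayGraphFor rg
      open IsPathSystem pathSystem

      Adj : Rel I 0ℓ
      Adj = RayGraphAdj G rays paths

      neighbours : ∀ i → Countable (Adj i)
      neighbours i = spokes (rays i) rays disjoint (λ (_ , f , _) n → paths (f n))
        (λ (_ , _ , join , disj) → Sum.swap ∘ join , disj) meet
        where
        -- By independence a common vertex is an endpoint of both paths. It cannot lie on both of
        -- the disjoint rays `k` and `k′`, which leaves the ray `i`.
        meet : ∀ {k k′} → k ≢ k′ → (q : Adj i k) (q′ : Adj i k′) → ∀ m n {x} →
               OnPath G (paths (proj₁ (proj₂ q) m)) x → OnPath G (paths (proj₁ (proj₂ q′) n)) x →
               OnRay G (rays i) x
        meet {k} {k′} k≢k′ (i≢k , f , join , _) (i≢k′ , g , join′ , _) m n {x} x∈p x∈p′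
          = conclude (endpoint-or-inner (paths (f m)) x∈p) (endpoint-or-inner (paths (g n)) x∈p′)
          where
          on : Endpoint (paths (f m)) x → OnRay G (rays i) x ⊎ OnRay G (rays k) x
          on = endpoint-on {paths (f m)} {rays i} {rays k} (join m)

          on′ : Endpoint (paths (g n)) x → OnRay G (rays i) x ⊎ OnRay G (rays k′) x
          on′ = endpoint-on {paths (g n)} {rays i} {rays k′} (join′ n)

          -- In each orientation a shared path would have an endpoint on two disjoint rays.
          differ : f m ≢ g n
          differ eq with join m
                         | subst (λ j → Joins G (paths j) (rays i) (rays k′)) (sym eq) (join′ n)
          ... | inj₁ (_ , t) | inj₁ (_ , t′) = disjoint k≢k′ t t′
          ... | inj₁ (s , _) | inj₂ (s′ , _) = disjoint i≢k′ s s′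
          ... | inj₂ (s , _) | inj₁ (s′ , _) = disjoint i≢k s′ s
          ... | inj₂ (s , _) | inj₂ (s′ , _) = disjoint k≢k′ s s′

          conclude : Endpoint (paths (f m)) x ⊎ InnerOf G (paths (f m)) x →
                     Endpoint (paths (g n)) x ⊎ InnerOf G (paths (g n)) x → OnRay G (rays i) x
          conclude (inj₂ inner) _            = ⊥-elim (independent differ inner x∈p′)
          conclude (inj₁ _)     (inj₂ inner) = ⊥-elim (independent (≢-sym differ) inner x∈p)
          conclude (inj₁ end)   (inj₁ end′) with on end | on′ end′
          ... | inj₁ c | _      = c
          ... | inj₂ _ | inj₁ c = c
          ... | inj₂ l | inj₂ l′ = ⊥-elim (disjoint k≢k′ l l′)

    star-countable : CountableSpokes → ∀ {ε K} → StarOfRays G ε K → Countable {K} U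
    star-countable spokes star =
      spokes centre leaf leavesDisjoint (λ {k} _ → paths k) (λ {k} _ → join k)
             (λ k≢k′ _ _ → meetOnCentre k≢k′)
      where open StarOfRays star

  -- The graph T # ℕ

  module Product (Ω : Omega₁) (T : OrderTree) (aronszajn : IsAronszajn Ω T)
                 {A : ℕ → Pred (OrderTree.Node T) 0ℓ} (semiSpecial : IsSemiSpecial T A) where
    private module Ω = Omega₁ Ω
    open Ordinals Ω
    open OrderTree T
    open Heights Ω T
    open Aronszajn aronszajn
    open Sequences semiSpecial

    G : Graph
    G = T#ℕ Ω T A

    open Graph G using (Vertex; _~_)
    open Walks G

    -- Equivalence of all rays

    layer-connected : ∀ {P : Pred Vertex 0ℓ} n → (∀ v → P (v , n)) →
                      ∀ v → Star (Inside P) (v , n) (root , n)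
    layer-connected {P} n all v = go v (wellFounded v)
      where
      go : ∀ v → Acc _<_ v → Star (Inside P) (v , n) (root , n)
      go v (acc rs) with classify v
      ... | inj₁ refl = done
      ... | inj₂ (inj₁ (u , pred)) =
        (bwd (successor n pred) , all v , all u) ◅ go u (rs (proj₁ pred))
      ... | inj₂ (inj₂ lim) = let u , c = C-exists lim n in
        (bwd (limit n lim c) , all v , all u) ◅ go u (rs (C⇒< T c))

    climb : ∀ {P : Pred Vertex 0ℓ} {u m n} → m ℕ.≤′ n → (∀ {k} → m ℕ.≤ k → P (u , k)) →
            Star (Inside P) (u , m) (u , n)
    climb ℕ.≤′-refl             all = done
    climb {u = u} (ℕ.≤′-step {n = n} m≤n) all =
      climb m≤n all ◅◅
      ((fwd (vertical u n) , all (ℕₚ.≤′⇒≤ m≤n) , all (ℕₚ.m≤n⇒m≤1+n (ℕₚ.≤′⇒≤ m≤n))) ◅ done)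

    -- Adds to `X` everything below it in its columns: climbing from a vertex outside this finite
    -- set never meets `X`.
    shadow : List Vertex → List Vertex
    shadow = concatMap λ (u , n) → map (u ,_) (upTo (suc n))

    ∉shadow : ∀ {X u m} → (u , m) ∉ shadow X → ∀ {k} → m ℕ.≤ k → (u , k) ∉ X
    ∉shadow um∉ m≤k uk∈X =
      um∉ (∈-concatMap⁺ _ (lose uk∈X (∈-map⁺ (_ ,_) (∈-upTo⁺ (s≤s m≤k)))))

    rays-equivalent : ∀ r s → Equivalent G r s
    rays-equivalent r s = equivalent r s connect
      where
      open Ray

      connect : ∀ X → ∃ λ i → ∃ λ j → at r i ∉ X × Star (Inside (_∉ X)) (at r i) (at s j)
      connect X
        with i , ri∉ ← escape (inj r) (shadow X)
        with j , sj∉ ← escape (inj s) (shadow X)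
        -- A layer at least as high as both starting vertices and free of `X`, in which the two
        -- climbs are connected through the root.
        with k , N∉ ← escape {f = λ k → (proj₂ (at r i) + proj₂ (at s j)) + k}
                             (λ {a} {b} → ℕₚ.+-cancelˡ-≡ _ a b) (map proj₂ X) =
        i , j , ∉shadow ri∉ ℕₚ.≤-refl ,
        (toRoot ri∉ (ℕₚ.≤-trans (ℕₚ.m≤m+n _ _) (ℕₚ.m≤m+n _ k)) ◅◅
         reverse-inside (toRoot sj∉ (ℕₚ.≤-trans (ℕₚ.m≤n+m _ (proj₂ (at r i))) (ℕₚ.m≤m+n _ k))))
        where
        N : ℕ
        N = (proj₂ (at r i) + proj₂ (at s j)) + k

        toRoot : ∀ {u m} → (u , m) ∉ shadow X → m ℕ.≤ N →
                 Star (Inside (_∉ X)) (u , m) (root , N)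
        toRoot {u} um∉ m≤N =
          climb (ℕₚ.≤⇒≤′ m≤N) (∉shadow um∉) ◅◅
          layer-connected N (λ v v∈X → N∉ (∈-map⁺ proj₂ v∈X)) u

    -- Disjoint rays and the degree

    column : Node → Ray G
    column v = record
      { at = v ,_ ; edge = λ n → fwd (vertical v n) ; inj = λ { refl → refl } }

    columns-disjoint : PairwiseDisjoint G (column ∘ levelNode)
    columns-disjoint α≢β (_ , refl) (_ , eq) = α≢β (sym (levelNode-injective (cong proj₁ eq)))

    disjoint-rays-bound : ∀ {I : Set} (R : I → Ray G) → PairwiseDisjoint G R → I ↣ Ω.Ord
    disjoint-rays-bound {I} R disj = Node×ℕ↣Ord ↣-∘ mk↣ {to = λ i → Ray.at (R i) 0} start-injective
      where
      start-injective : Injective _≡_ _≡_ (λ i → Ray.at (R i) 0)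
      start-injective {i} {j} eq with em {i ≡ j}
      ... | yes i≡j = i≡j
      ... | no i≢j  = ⊥-elim (disj i≢j (0 , eq) (0 , refl))

    -- Leaving the cone above a limit node

    Cone : Node → Pred Vertex 0ℓ
    Cone v (x , _) = v ≤ x

    -- Only an edge going down in the tree can leave the cone. A successor edge would make `v` a
    -- successor node or place it strictly between a node and its predecessor; a limit edge ends in
    -- some `cₙ`, to which `C-restrict` applies.
    cone-exit : ∀ {v} → ¬ IsSuccessorNode v →
                ∀ {x y} → Cone v x → ¬ Cone v y → x ~ y → C T A v (proj₂ y) (proj₁ y)
    cone-exit ¬succ v≤x v≰y (fwd (vertical _ _)) = ⊥-elim (v≰y v≤x)
    cone-exit ¬succ v≤x v≰y (bwd (vertical _ _)) = ⊥-elim (v≰y v≤x)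
    cone-exit ¬succ v≤x v≰y (fwd (successor _ ((x≤y , _) , _))) =
      ⊥-elim (v≰y (≤-trans v≤x x≤y))
    cone-exit ¬succ v≤x v≰y (fwd (limit _ _ c)) =
      ⊥-elim (v≰y (≤-trans v≤x (proj₁ (C⇒< T c))))
    cone-exit {v} ¬succ {x , _} v≤x v≰y (bwd (successor _ pred@(y<x , gap))) with em {v ≡ x}
    ... | yes refl = ⊥-elim (¬succ (_ , pred))
    ... | no v≢x with ≤⊎> v≤x (proj₁ y<x)
    ...   | inj₁ v≤y = ⊥-elim (v≰y v≤y)
    ...   | inj₂ y<v = ⊥-elim (gap v y<v (v≤x , v≢x))
    cone-exit ¬succ v≤x v≰y (bwd (limit _ _ c)) with ≤⊎> v≤x (proj₁ (C⇒< T c))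
    ... | inj₁ v≤y = ⊥-elim (v≰y v≤y)
    ... | inj₂ y<v = C-restrict v≤x c y<v

    limit⇒¬successor : ∀ {v} → IsLimitNode Ω T v → ¬ IsSuccessorNode v
    limit⇒¬successor lim (u , u<v , gap) =
      let w , (u<w , _) , w<v = immediateSuccessor lim u<v in gap w u<w w<v

    -- Disjoint paths out of the cone at v leave it at distinct points (cₙ , n), so
    -- these occur with arbitrarily large n.
    exits-unbounded : ∀ {v} → IsLimitNode Ω T v → (s r : Ray G) →
                      (∀ n → Cone v (Ray.at s n)) → (∀ n → ¬ Cone v (Ray.at r n)) →
                      ∀ P → DisjointlyJoins G P s r → ∀ k →
                      ∃ λ m → ∃ λ u → ∃ λ n → OnPath G (P m) (u , n) × C T A v n u × k ℕ.≤ n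
    exits-unbounded {v} lim s r s-in r-out P (joins , disj) k =
      let m , level∉ = escape level-injective (upTo k)
          (u , n) , on , c = crossing m
      in m , u , n , on , c , ℕₚ.≮⇒≥ (level∉ ∘ ∈-upTo⁺)
      where
      exit : ∀ {x y} → Cone v x → ¬ Cone v y → x ~ y → C T A v (proj₂ y) (proj₁ y)
      exit = cone-exit (limit⇒¬successor lim)

      crossing : ∀ m → ∃ λ z → OnPath G (P m) z × C T A v (proj₂ z) (proj₁ z)
      crossing m with joins m
      ... | inj₁ ((i , source≡) , (j , target≡)) =
        exit-vertex exit (Path.walk (P m)) (subst (Cone v) source≡ (s-in i))
                    (subst (¬_ ∘ Cone v) target≡ (r-out j))
      ... | inj₂ ((j , source≡) , (i , target≡)) =
        entry-vertex exit (Path.walk (P m)) (subst (¬_ ∘ Cone v) source≡ (r-out j))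
                     (subst (Cone v) target≡ (s-in i))

      level : ℕ → ℕ
      level m = proj₂ (proj₁ (crossing m))

      -- A level `n` admits only the exit vertex `(cₙ , n)`, which cannot lie on two disjoint paths.
      level-injective : Injective _≡_ _≡_ level
      level-injective {m} {m′} eq with em {m ≡ m′}
      ... | yes m≡m′ = m≡m′
      ... | no m≢m′  = let (u , n) , on , c = crossing m ; (u′ , n′) , on′ , c′ = crossing m′ in
        ⊥-elim (disj m≢m′ on
          (subst (OnPath G (P m′))
                 (cong₂ _,_ (C-unique c′ (subst (λ n → C T A v n u) eq c)) (sym eq)) on′))

    -- Countably many spokes at every ray

    countableSpokes : CountableSpokes
    countableSpokes r {I} {Q} leaf disj paths join meet =
      countable-⊆ split (countable-∪ meeting-countable high-countable)
      where
      bound : ∃ λ τ → ∀ n → ht (proj₁ (Ray.at r n)) Ω.< τ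
      bound = strictBound (λ n → ht (proj₁ (Ray.at r n)))

      τ : Ω.Ord
      τ = proj₁ bound

      limitLevel : ∃ λ σ → τ Ω.< σ × Ω.IsLimit σ
      limitLevel = limitAbove τ

      σ : Ω.Ord
      σ = proj₁ limitLevel

      τ<σ : τ Ω.< σ
      τ<σ = proj₁ (proj₂ limitLevel)

      Low : Pred Vertex 0ℓ
      Low (x , _) = ht x Ω.< σ

      low-countable : Countable Low
      low-countable = countable-⊆ (λ x<σ → x<σ , _) (countable-× (below-countable σ) ℕ-countable)

      Meeting High : Pred I 0ℓ
      Meeting k = ∃ λ z → Low z × OnRay G (leaf k) z
      High k = Q k × ¬ Meeting k

      split : Q ⊆ (Meeting ∪ High)
      split {k} q with em {Meeting k}
      ... | yes m = inj₁ m
      ... | no ¬m = inj₂ (q , ¬m)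

      meeting-countable : Countable Meeting
      meeting-countable = countable-via (λ k z → OnRay G (leaf k) z) low-countable id shared
        where
        shared : ∀ {k k′ z} → Meeting k → Meeting k′ →
                 OnRay G (leaf k) z → OnRay G (leaf k′) z → k ≡ k′
        shared {k} {k′} _ _ z∈ z∈′ with em {k ≡ k′}
        ... | yes eq = eq
        ... | no k≢k′ = ⊥-elim (disj k≢k′ z∈ z∈′)

      -- Path families of distinct rays meet only on `r`, so such a `z` determines `k`.
      Separates : I → Vertex → Set
      Separates k z = Σ (Q k) λ q → ∃ λ m → OnPath G (paths q m) z × ¬ OnRay G r z

      separator : ∀ {k} → High k → ∃ λ z → Low z × Separates k z
      separator {k} (q , ¬meeting) =
        let v , v≤start , hv≡σ = ancestorAt (λ start<σ → ¬meeting (Ray.at s 0 , start<σ , 0 , refl))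
            -- The height `τ` exceeds all heights on `r`, so `r` avoids the cone above `w₀`.
            w₀ , w₀≤v , hw₀≡τ  = ancestorAt (λ hv<τ → <-asym τ<σ (subst (Ω._< τ) hv≡σ hv<τ))
        in separate v≤start hv≡σ w₀≤v hw₀≡τ
        where
        s : Ray G
        s = leaf k

        -- Leaving the cone would take the ray to a node below `v`, hence of height less than `σ`,
        -- where `s` has no vertex.
        stays : ∀ {v} → v ≤ proj₁ (Ray.at s 0) → ht v ≡ σ → ¬ IsSuccessorNode v →
                ∀ n → Cone v (Ray.at s n)
        stays v≤start hv≡σ ¬succ zero = v≤start
        stays {v} v≤start hv≡σ ¬succ (suc n) with em {Cone v (Ray.at s (suc n))}
        ... | yes inside = inside
        ... | no outside = ⊥-elim (¬meeting (_ , low , suc n , refl))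
          where
          low : Low (Ray.at s (suc n))
          low = subst (ht _ Ω.<_) hv≡σ (ht-mono-< (C⇒< T
                  (cone-exit ¬succ (stays v≤start hv≡σ ¬succ n) outside (Ray.edge s n))))

        separate : ∀ {v w₀} → v ≤ proj₁ (Ray.at s 0) → ht v ≡ σ → w₀ ≤ v → ht w₀ ≡ τ →
                   ∃ λ z → Low z × Separates k z
        separate {v} {w₀} v≤start hv≡σ w₀≤v hw₀≡τ =
          -- The label `l` of a successor `w` of `w₀` is the threshold: no `cₙ` with `n` at least
          -- `l` lies below `w`.
          let w , pred@(w₀<w , _) , w<v = immediateSuccessor lim w₀<v
              l , Aw = proj₁ (IsSemiSpecial.union semiSpecial) (_ , pred)
              m , u , n , on , c , l≤n = exits-unbounded lim s r
                (stays v≤start hv≡σ (limit⇒¬successor lim)) (λ i v≤ri → r≱w₀ i (≤-trans w₀≤v v≤ri))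
                (paths q) (join q) l
          in (u , n) , subst (ht u Ω.<_) hv≡σ (ht-mono-< (C⇒< T c)) ,
             q , m , on , off w₀<w w<v Aw c l≤n
          where
          lim : IsLimitNode Ω T v
          lim = σ , subst (HasHeight Ω T v) hv≡σ (hasHeight v) , proj₂ (proj₂ limitLevel)

          w₀<v : w₀ < v
          w₀<v = w₀≤v , λ { refl → <-irrefl (trans (sym hw₀≡τ) hv≡σ) τ<σ }

          r≱w₀ : ∀ i → ¬ w₀ ≤ proj₁ (Ray.at r i)
          r≱w₀ i w₀≤ri = <-irrefl refl
            (≤-<-trans (ht-≤ w₀≤ri) (subst (_ Ω.<_) (sym hw₀≡τ) (proj₂ bound i)))

          -- Both `w` and `u` lie below `v`, so they are comparable: `w ≤ u` puts `u` above `w₀`,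
          -- where `r` has no vertex, and `u < w` would force `n < l`.
          off : ∀ {w l u n} → w₀ < w → w < v → A l w → C T A v n u → l ℕ.≤ n → ¬ OnRay G r (u , n)
          off w₀<w w<v Aw c l≤n (i , eq) with ≤⊎> (proj₁ w<v) (proj₁ (C⇒< T c))
          ... | inj₁ w≤u = r≱w₀ i (subst (λ x → w₀ ≤ proj₁ x) (sym eq) (≤-trans (proj₁ w₀<w) w≤u))
          ... | inj₂ u<w = ℕₚ.<⇒≱ (C-label-bound c u<w w<v Aw) l≤n

      high-countable : Countable High
      high-countable = countable-via Separates low-countable separator shared
        where
        shared : ∀ {k k′ z} → High k → High k′ → Separates k z → Separates k′ z → k ≡ k′
        shared {k} {k′} _ _ (q , m , z∈ , z∉r) (q′ , n , z∈′ , _) with em {k ≡ k′}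
        ... | yes eq = eq
        ... | no k≢k′ = ⊥-elim (z∉r (meet k≢k′ q q′ m n z∈ z∈′))

    -- The unique end, its degree, and the absence of ray graphs and stars

    uncountable-index : ∀ {I : Set} → Ω.Ord ↣ I → ¬ Countable {I} U
    uncountable-index emb (f , f-inj) =
      Ω.uncountable (f ∘ Injection.to emb , λ _ _ eq → Injection.injective emb (f-inj _ _ eq))

    AllRays : Pred (Ray G) 0ℓ
    AllRays _ = ⊤

    allRays-isEnd : IsEnd G AllRays
    allRays-isEnd = column root , (λ {r} _ → rays-equivalent (column root) r) , _

    allRays-unique : ∀ ε′ → IsEnd G ε′ → ε′ ≐ AllRays
    allRays-unique ε′ (r , _ , equivalent⊆ε′) = _ , λ {s} _ → equivalent⊆ε′ (rays-equivalent r s)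

    levelColumns : DisjointRaysIn G AllRays Ω.Ord
    levelColumns = column ∘ levelNode , _ , columns-disjoint

    hasDegree-ℵ₁ : HasDegree G AllRays Ω.Ord
    hasDegree-ℵ₁ = levelColumns , λ I (R , _ , disj) → disjoint-rays-bound R disj

    -- Maximality in `card`, applied to the ℵ₁ columns, injects ω₁ into the index set of the ray
    -- graph.
    no-rayGraph : ¬ RayGraphFor G AllRays
    no-rayGraph rg = uncountable-index (proj₂ (RayGraphFor.card rg) Ω.Ord levelColumns)
                                       (rayGraph-countable countableSpokes rg)

    no-star : ¬ StarOfRays G AllRays Ω.Ord
    no-star star = Ω.uncountable (star-countable countableSpokes star)

mainTheorem2 : ExcludedMiddle 0ℓ →
    (Ω : Omega₁) (T : OrderTree) → IsAronszajn Ω T →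
    (A : ℕ → Pred (OrderTree.Node T) 0ℓ) → IsSemiSpecial T A →
    let G = T#ℕ Ω T A in
    Σ (Pred (Ray G) 0ℓ) λ ε →
    (IsEnd G ε × (∀ ε′ → IsEnd G ε′ → ε′ ≐ ε)) ×
    HasDegree G ε (Omega₁.Ord Ω) ×
    (¬ RayGraphFor G ε) ×
    (¬ StarOfRays G ε (Omega₁.Ord Ω))
mainTheorem2 em Ω T aronszajn A semiSpecial =
  AllRays , (allRays-isEnd , allRays-unique) , hasDegree-ℵ₁ , no-rayGraph , no-star
  where open Classical.Product em Ω T aronszajn semiSpecial
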